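{- There exists an integer $\delta_0$ such that every finite simple bipartite graph $G$ with $\delta(G)\ge\delta_0$ satisfies $\chi_2(G)-\chi(G)\le 2\left\lceil\frac{\Delta(G)}{\delta(G)}\right\rceil$.
   Context: $\delta$ and $\Delta$ denote minimum and maximum degree, $\chi$ the chromatic number. A dynamic coloring of $G$ is a proper vertex coloring such that for every vertex $v$ of degree at least $2$, the neighbours of $v$ receive at least two different colors; $\chi_2(G)$ is the smallest number of colors in a dynamic coloring of $G$. -}

module Defs where

open import Data.Nat using (ℕ; zero; suc; _+_; _*_; _∸_; _≤_; _⊓_; _⊔_; NonZero)
open import Data.Nat.DivMod using (_/_)
open import Data.Bool using (Bool; true; false; if_then_else_)
open import Data.Fin using (Fin)
open import Data.List using (List; map; foldr; allFin)
open import Data.Nat.ListAction using (sum)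
open import Data.Product using (Σ; ∃; _×_; _,_)
open import Relation.Binary.PropositionalEquality using (_≡_; _≢_)

record Graph (n : ℕ) : Set where
  field
    adj   : Fin n → Fin n → Bool
    sym   : ∀ u v → adj u v ≡ adj v u
    irrfl : ∀ v → adj v v ≡ false
open Graph public

Adj : ∀ {n} → Graph n → Fin n → Fin n → Set
Adj G u v = adj G u v ≡ true

deg : ∀ {n} → Graph n → Fin n → ℕ
deg {n} G v = sum (map (λ u → if adj G v u then 1 else 0) (allFin n))

minDeg : ∀ {n} → Graph (suc n) → ℕ
minDeg {n} G = foldr _⊓_ (deg G Fin.zero) (map (deg G) (allFin (suc n)))

maxDeg : ∀ {n} → Graph (suc n) → ℕ
maxDeg {n} G = foldr _⊔_ 0 (map (deg G) (allFin (suc n)))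

Proper : ∀ {n} → Graph n → (k : ℕ) → (Fin n → Fin k) → Set
Proper G k c = ∀ u v → Adj G u v → c u ≢ c v

Colorable : ∀ {n} → Graph n → ℕ → Set
Colorable {n} G k = Σ (Fin n → Fin k) (Proper G k)

Bipartite : ∀ {n} → Graph n → Set
Bipartite G = Colorable G 2

Dynamic : ∀ {n} → Graph n → (k : ℕ) → (Fin n → Fin k) → Set
Dynamic G k c = Proper G k c ×
  (∀ v → 2 ≤ deg G v →
     ∃ λ u → ∃ λ w → Adj G v u × Adj G v w × c u ≢ c w)

DynColorable : ∀ {n} → Graph n → ℕ → Set
DynColorable {n} G k = Σ (Fin n → Fin k) (Dynamic G k)

IsChromaticNumber : ∀ {n} → Graph n → ℕ → Set
IsChromaticNumber G k = Colorable G k × (∀ j → Colorable G j → k ≤ j)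

IsDynChromaticNumber : ∀ {n} → Graph n → ℕ → Set
IsDynChromaticNumber G k = DynColorable G k × (∀ j → DynColorable G j → k ≤ j)

-- ceiling division ⌈a / b⌉; the b = 0 case is a junk value, never used
-- in the statement (there b = δ(G) ≥ δ₀ ≥ 1)
ceilDiv : ℕ → ℕ → ℕ
ceilDiv a zero    = 0
ceilDiv a (suc b) = (a + b) / suc b

{-# OPTIONS --safe #-}
-- With r = ⌈Δ/δ⌉, it suffices to colour the vertices with r + 1 colours so that no neighbourhood is
-- monochromatic: pairing this colour with the side of the bipartition is a dynamic colouring with
-- 2 (r + 1) = 2 + 2 r colours, and χ ≥ 2.  Such a colouring is found by Rosenfeld's counting
-- argument.  Let c(S) be the number of colourings with no monochromatic neighbourhood inside S.
-- By induction on S, c(S) ≥ β/k · c(S − i) for k = r + 1 and β = r + 1/2: a colouring lost on passing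
-- from S − i to S is constant on some e ∋ i, and as the colours on e are unconstrained by
-- S − i − e, at most k^(1−|e|) c(S − i − e) ≤ β^(1−|e|) c(S − i) colourings are lost for each
-- of the at most Δ ≤ r δ neighbourhoods e through i.  For δ ≥ 11 the total loss is at most
-- c(S − i) / 2k.

module Submission where

open import Defs
open import Data.Bool using (true; false; if_then_else_)
import Data.Bool.Properties as Bool
open import Data.Fin using (Fin; zero; suc; combine)
import Data.Fin as Fin
import Data.Fin.Properties as Fin
open import Data.Fin.Subset using (Subset; inside; outside; ⊤; _-_; _⊆_; _⊂_)
  renaming (_∈_ to _∈ₛ_; _∉_ to _∉ₛ_)
open import Data.Fin.Subset.Induction using (Acc; acc; ⊂-wellFounded)
open import Data.Fin.Subset.Properties
  using (_∈?_; p─q⊆p; x∈p∧x≢y⇒x∈p-y; x∈p⇒p-x⊂p; ⊆-⊂-trans; ∈⊤)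
open import Data.List using (List; []; _∷_; map; filter; length; take; allFin)
open import Data.List.Membership.Propositional using (_∈_; find; lose)
open import Data.List.Membership.Propositional.Properties
  using (∈-map⁺; ∈-filter⁺; ∈-filter⁻; ∈-allFin)
import Data.List.Membership.DecPropositional as DecMembership
open import Data.List.Properties using (foldr-preservesᵒ; filter-all; length-take)
open import Data.List.Relation.Unary.All as All using (All; []; _∷_)
import Data.List.Relation.Unary.All.Properties as All
open import Data.List.Relation.Unary.AllPairs using ([]; _∷_)
open import Data.List.Relation.Unary.Any as Any using (Any; here; there)
open import Data.List.Relation.Unary.Unique.Propositional using (Unique)
import Data.List.Relation.Unary.Unique.Propositional.Properties as Unique
open import Data.Nat hiding (_/_; _≟_)
open import Data.Nat.DivMod using (_/_; _%_; m≡m%n+[m/n]*n; m%n<n)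
open import Data.Nat.ListAction using (sum)
open import Data.Nat.Properties hiding (_≟_)
open import Data.Nat.Tactic.RingSolver using (solve-∀)
open import Data.Product using (Σ; ∃; _×_; _,_; proj₁; proj₂)
open import Data.Sum using (inj₂)
import Data.Sum as Sum
open import Data.Vec using (Vec; []; _∷_; lookup; _[_]≔_; here; there)
open import Data.Vec.Properties using (lookup∘update; lookup∘update′)
open import Function using (_∘_; id)
open import Relation.Binary.PropositionalEquality as ≡
  using (_≡_; _≢_; refl; cong; cong₂; trans; subst; module ≡-Reasoning)
open import Relation.Nullary using (¬_; Dec; yes; no; does; contradiction)
open import Relation.Nullary.Decidable using (_×-dec_; ¬?)

open import Algebra.Properties.Semiring.Sum +-*-semiring
  using (sum-syntax; *-distribˡ-sum; ∑-comm; ∑-distrib-+; sum-cong-≗)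
  renaming (sum to ∑)

open import Algebra.Properties.CommutativeSemigroup *-commutativeSemigroup
  using (interchange; x∙yz≈y∙xz; x∙yz≈yx∙z; xy∙z≈y∙xz)

open module FinMembership {n} = DecMembership (Fin._≟_ {n}) using () renaming (_∈?_ to _∈ₑ?_)

private
  variable
    A B : Set
    k N : ℕ

-- Indicators and finite sums.

𝟙 : Dec A → ℕ
𝟙 a? = if does a? then 1 else 0

𝟙-mono : (a? : Dec A) (b? : Dec B) → (A → B) → 𝟙 a? ≤ 𝟙 b?
𝟙-mono (no _)  _       _ = z≤n
𝟙-mono (yes _) (yes _) _ = ≤-refl
𝟙-mono (yes a) (no ¬b) f = contradiction (f a) ¬b

𝟙-cong : (a? : Dec A) (b? : Dec B) → (A → B) → (B → A) → 𝟙 a? ≡ 𝟙 b?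
𝟙-cong a? b? f g = ≤-antisym (𝟙-mono a? b? f) (𝟙-mono b? a? g)

𝟙-yes : (a? : Dec A) → A → 𝟙 a? ≡ 1
𝟙-yes (yes _) _ = refl
𝟙-yes (no ¬a) a = contradiction a ¬a

𝟙-bound : ∀ {x} (a? : Dec A) → (A → 1 ≤ x) → 𝟙 a? ≤ x
𝟙-bound (no _)  _   = z≤n
𝟙-bound (yes a) 1≤x = 1≤x a

𝟙-positive : (a? : Dec A) → 0 < 𝟙 a? → A
𝟙-positive (yes a) _ = a

∑-mono : {f g : Fin k → ℕ} → (∀ c → f c ≤ g c) → ∑ f ≤ ∑ g
∑-mono {zero}  f≤g = z≤n
∑-mono {suc k} f≤g = +-mono-≤ (f≤g zero) (∑-mono (f≤g ∘ suc))

∑-zero : ∀ k → ∑[ c < k ] 0 ≡ 0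
∑-zero zero    = refl
∑-zero (suc k) = ∑-zero k

∑-positive : (f : Fin k → ℕ) → 0 < ∑ f → ∃ λ c → 0 < f c
∑-positive {suc k} f 0<∑ with f zero in eq
... | suc _ = zero , subst (0 <_) (≡.sym eq) z<s
... | zero  with ∑-positive (f ∘ suc) 0<∑
...   | c , 0<fc = suc c , 0<fc

∑-point : (a : Fin k) → ∑[ c < k ] 𝟙 (c Fin.≟ a) ≡ 1
∑-point {suc k} zero    = cong suc (∑-zero k)
∑-point {suc k} (suc a) = ∑-point a

-- Sums over all colourings, and resampling the colour of one vertex.

Colouring : ℕ → ℕ → Set
Colouring k N = Vec (Fin k) N

total : (Colouring k N → ℕ) → ℕ
total {N = zero}  g = g []
total {N = suc N} g = ∑ λ c → total λ f → g (c ∷ f)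

total-cong : {g h : Colouring k N → ℕ} → (∀ f → g f ≡ h f) → total g ≡ total h
total-cong {N = zero}  g≗h = g≗h []
total-cong {N = suc N} g≗h = sum-cong-≗ λ c → total-cong λ f → g≗h (c ∷ f)

total-mono : {g h : Colouring k N → ℕ} → (∀ f → g f ≤ h f) → total g ≤ total h
total-mono {N = zero}  g≤h = g≤h []
total-mono {N = suc N} g≤h = ∑-mono λ c → total-mono λ f → g≤h (c ∷ f)

total-+ : (g h : Colouring k N → ℕ) → total (λ f → g f + h f) ≡ total g + total h
total-+ {N = zero}  g h = refl
total-+ {N = suc N} g h =
  trans (sum-cong-≗ λ c → total-+ (g ∘ (c ∷_)) (h ∘ (c ∷_)))
        (∑-distrib-+ (λ c → total (g ∘ (c ∷_))) λ c → total (h ∘ (c ∷_)))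

total-zero : total {k} {N} (λ _ → 0) ≡ 0
total-zero {N = zero}      = refl
total-zero {k} {N = suc N} = trans (sum-cong-≗ {k} λ _ → total-zero {N = N}) (∑-zero k)

total-positive : (g : Colouring k N → ℕ) → 0 < total g → ∃ λ f → 0 < g f
total-positive {N = zero}  g 0<g = [] , 0<g
total-positive {N = suc N} g 0<g with ∑-positive _ 0<g
... | c , 0<gc with total-positive (g ∘ (c ∷_)) 0<gc
...   | f , 0<gf = c ∷ f , 0<gf

total-∑ : ∀ {j} (g : Fin j → Colouring k N → ℕ) →
          total (λ f → ∑ λ c → g c f) ≡ ∑ λ c → total (g c)
total-∑ {N = zero}  g = refl
total-∑ {N = suc N} g =
  trans (sum-cong-≗ λ d → total-∑ λ c f → g c (d ∷ f))
        (∑-comm λ d c → total λ f → g c (d ∷ f))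

-- Double counting: every colouring arises as `f [ i ]≔ c` from exactly `k` pairs `f`, `c`, since
-- `c` is forced to be its colour at `i` while the old colour of `f` at `i` is free.
total-resample : (i : Fin N) (g : Colouring k N → ℕ) →
                 k * total g ≡ total λ f → ∑ λ c → g (f [ i ]≔ c)
total-resample {suc N} {k} zero g = begin
  k * total g                              ≡⟨ ∑-const k ⟨
  ∑[ _ < k ] total g                       ≡⟨⟩
  ∑[ _ < k ] ∑ (λ c → total (g ∘ (c ∷_)))  ≡⟨ sum-cong-≗ {k} (λ _ → total-∑ λ c → g ∘ (c ∷_)) ⟨
  ∑[ _ < k ] total (λ f → ∑ λ c → g (c ∷ f)) ∎
  where
  open ≡-Reasoning
  ∑-const : ∀ j {x} → ∑[ _ < j ] x ≡ j * x
  ∑-const zero    = refl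
  ∑-const (suc j) = cong (_ +_) (∑-const j)
total-resample {suc N} {k} (suc i) g =
  trans (*-distribˡ-sum k λ c → total (g ∘ (c ∷_)))
        (sum-cong-≗ λ c → total-resample i (g ∘ (c ∷_)))

_IgnoresColourOf_ : (Colouring k N → ℕ) → Fin N → Set
h IgnoresColourOf j = ∀ f c → h (f [ j ]≔ c) ≡ h f

Agree : List (Fin N) → Fin N → Colouring k N → Set
Agree L i f = All (λ j → lookup f j ≡ lookup f i) L

agree? : (L : List (Fin N)) (i : Fin N) (f : Colouring k N) → Dec (Agree L i f)
agree? L i f = All.all? (λ j → lookup f j Fin.≟ lookup f i) L

-- Resampling `j` changes neither the colour of `i` nor `h`, and exactly one of the `k` new colours
-- matches that of `i`. In probabilistic terms, the collision has probability `1/k` independently of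
-- `h`.
total-collision : {i j : Fin N} (h : Colouring k N → ℕ) → i ≢ j → h IgnoresColourOf j →
                  k * total (λ f → 𝟙 (lookup f j Fin.≟ lookup f i) * h f) ≡ total h
total-collision {N} {k} {i} {j} h i≢j ignores =
  trans (total-resample j _) (total-cong λ f → begin
    ∑ (λ c → 𝟙 (lookup (f [ j ]≔ c) j Fin.≟ lookup (f [ j ]≔ c) i) * h (f [ j ]≔ c))
      ≡⟨ sum-cong-≗ (λ c → cong₂ _*_
           (cong₂ (λ a b → 𝟙 (a Fin.≟ b)) (lookup∘update j f c) (lookup∘update′ i≢j f c))
           (ignores f c)) ⟩
    ∑ (λ c → 𝟙 (c Fin.≟ lookup f i) * h f)
      ≡⟨ sum-cong-≗ (λ c → *-comm (𝟙 (c Fin.≟ lookup f i)) (h f)) ⟩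
    ∑ (λ c → h f * 𝟙 (c Fin.≟ lookup f i))
      ≡⟨ *-distribˡ-sum (h f) (λ c → 𝟙 (c Fin.≟ lookup f i)) ⟨
    h f * ∑ (λ c → 𝟙 (c Fin.≟ lookup f i))
      ≡⟨ cong (h f *_) (∑-point (lookup f i)) ⟩
    h f * 1
      ≡⟨ *-identityʳ (h f) ⟩
    h f ∎)
  where open ≡-Reasoning

𝟙-agree-∷ : ∀ u (L : List (Fin N)) i (f : Colouring k N) →
            𝟙 (agree? (u ∷ L) i f) ≡ 𝟙 (lookup f u Fin.≟ lookup f i) * 𝟙 (agree? L i f)
𝟙-agree-∷ u L i f with does (lookup f u Fin.≟ lookup f i)
... | true  = ≡.sym (+-identityʳ _)
... | false = refl

agree-ignores : {L : List (Fin N)} {i j : Fin N} → i ≢ j → All (j ≢_) L →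
                (λ (f : Colouring k N) → 𝟙 (agree? L i f)) IgnoresColourOf j
agree-ignores             i≢j []          f c = refl
agree-ignores {L = u ∷ L} {i} {j} i≢j (j≢u ∷ j∉L) f c = begin
  𝟙 (agree? (u ∷ L) i f′)                                ≡⟨ 𝟙-agree-∷ u L i f′ ⟩
  𝟙 (lookup f′ u Fin.≟ lookup f′ i) * 𝟙 (agree? L i f′)
    ≡⟨ cong₂ _*_ (cong₂ (λ a b → 𝟙 (a Fin.≟ b)) (lookup∘update′ (j≢u ∘ ≡.sym) f c)
                                                 (lookup∘update′ i≢j f c))
                 (agree-ignores i≢j j∉L f c) ⟩
  𝟙 (lookup f u Fin.≟ lookup f i) * 𝟙 (agree? L i f)     ≡⟨ 𝟙-agree-∷ u L i f ⟨
  𝟙 (agree? (u ∷ L) i f)                                 ∎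
  where
  open ≡-Reasoning
  f′ = f [ j ]≔ c

-- The vertices of `L` are peeled off one by one, each giving a factor `1/k`. Agreement on the
-- remaining vertices is absorbed into the weight; the new weight still ignores `j` because `j` is
-- neither `i` nor, by uniqueness, in the tail.
total-agree : {i : Fin N} (h : Colouring k N → ℕ) (L : List (Fin N)) → Unique L →
              All (i ≢_) L → All (h IgnoresColourOf_) L →
              k ^ length L * total (λ f → 𝟙 (agree? L i f) * h f) ≡ total h
total-agree h [] _ _ _ = trans (+-identityʳ _) (total-cong λ f → +-identityʳ (h f))
total-agree {N} {k} {i} h (j ∷ L) (j∉L ∷ L!) (i≢j ∷ i∉L) (hj ∷ hL) = begin
  k * k ^ length L * total (λ f → 𝟙 (agree? (j ∷ L) i f) * h f)
    ≡⟨ cong₂ _*_ (*-comm k (k ^ length L)) (total-cong λ f →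
         trans (cong (_* h f) (𝟙-agree-∷ j L i f)) (*-assoc (collides f) _ _)) ⟩
  k ^ length L * k * total (λ f → collides f * h′ f)
    ≡⟨ *-assoc (k ^ length L) k _ ⟩
  k ^ length L * (k * total (λ f → collides f * h′ f))
    ≡⟨ cong (k ^ length L *_) (total-collision h′ i≢j λ f c →
         cong₂ _*_ (agree-ignores i≢j j∉L f c) (hj f c)) ⟩
  k ^ length L * total h′
    ≡⟨ total-agree h L L! i∉L hL ⟩
  total h ∎
  where
  open ≡-Reasoning
  collides h′ : Colouring k N → ℕ
  collides f = 𝟙 (lookup f j Fin.≟ lookup f i)
  h′ f = 𝟙 (agree? L i f) * h f

-- Auxiliary facts on powers, lists and vertex sets.

^-distribʳ-* : ∀ m n o → (m * n) ^ o ≡ m ^ o * n ^ o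
^-distribʳ-* m n zero    = refl
^-distribʳ-* m n (suc o) =
  trans (cong (m * n *_) (^-distribʳ-* m n o)) (interchange m n (m ^ o) (n ^ o))

total-sum-≤ : ∀ {a b} (g : A → Colouring k N → ℕ) (xs : List A) →
              All (λ x → a * total (g x) ≤ b) xs →
              a * total (λ f → sum (map (λ x → g x f) xs)) ≤ length xs * b
total-sum-≤ {N = N} {a = a} g [] [] =
  ≤-reflexive (trans (cong (a *_) (total-zero {N = N})) (*-zeroʳ a))
total-sum-≤ {a = a} {b} g (x ∷ xs) (p ∷ ps) = begin
  a * total (λ f → g x f + rest f)     ≡⟨ cong (a *_) (total-+ (g x) rest) ⟩
  a * (total (g x) + total rest)       ≡⟨ *-distribˡ-+ a _ _ ⟩
  a * total (g x) + a * total rest     ≤⟨ +-mono-≤ p (total-sum-≤ {a = a} g xs ps) ⟩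
  b + length xs * b                    ∎
  where
  open ≤-Reasoning
  rest = λ f → sum (map (λ y → g y f) xs)

∈⇒≤sum : (g : A → ℕ) {x : A} {xs : List A} → x ∈ xs → g x ≤ sum (map g xs)
∈⇒≤sum g (here refl) = m≤m+n _ _
∈⇒≤sum g (there x∈)  = ≤-trans (∈⇒≤sum g x∈) (m≤n+m _ _)

x∉p-x : ∀ (p : Subset N) x → x ∉ₛ p - x
x∉p-x (inside  ∷ p) zero    ()
x∉p-x (outside ∷ p) zero    ()
x∉p-x (_ ∷ p)       (suc x) (there x∈) = x∉p-x p x x∈

p-x⊆p : ∀ (p : Subset N) x → p - x ⊆ p
p-x⊆p p x = p─q⊆p p _

length-without : ∀ (i : Fin N) {e} → Unique e →
                 length e ≤ suc (length (filter (¬? ∘ (i Fin.≟_)) e))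
length-without i []                 = z≤n
length-without i {u ∷ e} (u∉e ∷ e!) with i Fin.≟ u
... | yes refl = s≤s (≤-reflexive (cong length (≡.sym (filter-all (¬? ∘ (i Fin.≟_)) u∉e))))
... | no _     = s≤s (length-without i e!)

-- Hypergraph colourings without monochromatic edges.

Edge : ℕ → Set
Edge N = List (Fin N)

-- The pairwise form singles out no vertex of `e`; the empty edge counts as monochromatic.
Monochromatic : Colouring k N → Edge N → Set
Monochromatic f e = All (λ u → All (λ w → lookup f u ≡ lookup f w) e) e

monochromatic? : (f : Colouring k N) (e : Edge N) → Dec (Monochromatic f e)
monochromatic? f e = All.all? (λ u → All.all? (λ w → lookup f u Fin.≟ lookup f w) e) e

monochromatic-resp : (f g : Colouring k N) {e : Edge N} →
                     (∀ {u} → u ∈ e → lookup f u ≡ lookup g u) →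
                     Monochromatic f e → Monochromatic g e
monochromatic-resp f g f≗g mono = All.tabulate λ u∈ → All.tabulate λ w∈ →
  trans (≡.sym (f≗g u∈)) (trans (All.lookup (All.lookup mono u∈) w∈) (f≗g w∈))

remove : Subset N → List (Fin N) → Subset N
remove S []      = S
remove S (j ∷ L) = remove (S - j) L

remove-⊆ : ∀ (S : Subset N) L → remove S L ⊆ S
remove-⊆ S []      = id
remove-⊆ S (j ∷ L) = p-x⊆p S j ∘ remove-⊆ (S - j) L

∉-remove : ∀ (S : Subset N) {j} {L} → j ∈ L → j ∉ₛ remove S L
∉-remove S {j} {_ ∷ L} (here refl) = x∉p-x S j ∘ remove-⊆ (S - j) L
∉-remove S {j} {i ∷ L} (there j∈L) = ∉-remove (S - i) j∈L

module _ (E : List (Edge N)) where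

  ViolatedIn : Subset N → Colouring k N → Edge N → Set
  ViolatedIn S f e = All (_∈ₛ S) e × Monochromatic f e

  Good : Subset N → Colouring k N → Set
  Good S f = ¬ Any (ViolatedIn S f) E

  violatedIn? : ∀ S (f : Colouring k N) e → Dec (ViolatedIn S f e)
  violatedIn? S f e = All.all? (_∈? S) e ×-dec monochromatic? f e

  good? : ∀ S (f : Colouring k N) → Dec (Good S f)
  good? S f = ¬? (Any.any? (violatedIn? S f) E)

  good-⊆ : ∀ {S T} (f : Colouring k N) → T ⊆ S → Good S f → Good T f
  good-⊆ f T⊆S good = good ∘ Any.map λ (e⊆T , mono) → All.map T⊆S e⊆T , mono

  good-resp : ∀ {S} (f g : Colouring k N) → (∀ {u} → u ∈ₛ S → lookup f u ≡ lookup g u) →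
              Good S f → Good S g
  good-resp f g f≗g good = good ∘ Any.map λ (e⊆S , mono) →
    e⊆S , monochromatic-resp g f (≡.sym ∘ f≗g ∘ All.lookup e⊆S) mono

  -- Only edges lying wholly inside `S` are tested, so `Good S` depends on the colours of `S` alone.
  -- This is the independence that `total-agree` requires of its weight.
  good-ignores : ∀ {S j} → j ∉ₛ S → (λ (f : Colouring k N) → 𝟙 (good? S f)) IgnoresColourOf j
  good-ignores {S = S} {j} j∉S f c = 𝟙-cong (good? S (f [ j ]≔ c)) (good? S f)
    (good-resp (f [ j ]≔ c) f unchanged) (good-resp f (f [ j ]≔ c) (≡.sym ∘ unchanged))
    where
    unchanged : ∀ {u} → u ∈ₛ S → lookup (f [ j ]≔ c) u ≡ lookup f u
    unchanged u∈S = lookup∘update′ (λ { refl → j∉S u∈S }) f c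

  -- Rosenfeld's counting argument.

  module _ (r m D : ℕ)
           (unique  : All Unique E)
           (uniform : All (λ e → m < length e) E)
           (sparse  : ∀ i → length (filter (i ∈ₑ?_) E) ≤ D)
           -- With `k = r + 1` and `β = r + 1/2`, this is `D / β^m ≤ 1 / 2k` with denominators
           -- cleared: the loss over all edges through one vertex is at most a fraction `1 / 2k`.
           (budget  : 2 * suc r * (D * 2 ^ m) ≤ suc (2 * r) ^ m) where

    -- All N vertices are coloured, also those outside S, where the colours are free.
    count : Subset N → ℕ
    count S = total λ (f : Colouring (suc r) N) → 𝟙 (good? S f)

    -- β/k = (r + 1/2)/(r + 1) with denominators cleared.
    Growth : Subset N → Set
    Growth S = ∀ i → suc (2 * r) * count (S - i) ≤ 2 * suc r * count S

    -- Each vertex of `L` costs one use of the growth bound, at a set from which the earlier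
    -- vertices are already deleted; hence the hypothesis ranges over all subsets of `S`.
    growth-remove : ∀ L {S} → (∀ {T} → T ⊆ S → Growth T) →
                    suc (2 * r) ^ length L * count (remove S L) ≤ (2 * suc r) ^ length L * count S
    growth-remove []      growth = ≤-refl
    growth-remove (j ∷ L) {S} growth = begin
      b * b ^ l * count (remove (S - j) L)    ≡⟨ *-assoc b (b ^ l) _ ⟩
      b * (b ^ l * count (remove (S - j) L))  ≤⟨ *-monoʳ-≤ b (growth-remove L λ T⊆ → growth (p-x⊆p S j ∘ T⊆)) ⟩
      b * (K ^ l * count (S - j))             ≡⟨ x∙yz≈y∙xz b (K ^ l) _ ⟩
      K ^ l * (b * count (S - j))             ≤⟨ *-monoʳ-≤ (K ^ l) (growth id j) ⟩
      K ^ l * (K * count S)                   ≡⟨ x∙yz≈yx∙z (K ^ l) K _ ⟩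
      K * K ^ l * count S                     ∎
      where
      open ≤-Reasoning
      b = suc (2 * r)
      K = 2 * suc r
      l = length L

    -- Cut down to length exactly m, so that the same power of β appears for every edge.
    rest : Fin N → Edge N → List (Fin N)
    rest i e = take m (filter (¬? ∘ (i Fin.≟_)) e)

    module _ (i : Fin N) (S : Subset N) (growth : ∀ {T} → T ⊆ S - i → Growth T) where

      private
        S⁻ = S - i

      -- The second factor is weaker than goodness for S - i so as not to depend on
      -- the colours of rest i e.
      fails : Edge N → Colouring (suc r) N → ℕ
      fails e f = 𝟙 (agree? (rest i e) i f) * 𝟙 (good? (remove S⁻ (rest i e)) f)

      length-rest : ∀ {e} → Unique e → m < length e → length (rest i e) ≡ m
      length-rest e! m<e = trans (length-take m _) (m≤n⇒m⊓n≡m (≤-pred (≤-trans m<e (length-without i e!))))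

      -- Agreement on the `m` vertices of `rest i e` contributes a factor `1/k^m`, as the other
      -- condition ignores their colours. Passing from `remove S⁻ (rest i e)` back to `S⁻` costs at
      -- most `(k/β)^m` by growth. The powers of `k` cancel and leave `1/β^m`.
      total-fails : ∀ {e} → Unique e → m < length e →
                    suc (2 * r) ^ m * total (fails e) ≤ 2 ^ m * count S⁻
      total-fails {e} e! m<e = *-cancelˡ-≤ (suc r ^ m) {{m^n≢0 (suc r) m}} (begin
        suc r ^ m * (b ^ m * total (fails e))   ≡⟨ x∙yz≈y∙xz (suc r ^ m) (b ^ m) _ ⟩
        b ^ m * (suc r ^ m * total (fails e))
          ≡⟨ cong (λ l → b ^ m * (suc r ^ l * total (fails e))) |L|≡m ⟨
        b ^ m * (suc r ^ length L * total (fails e))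
          ≡⟨ cong (b ^ m *_) (total-agree {i = i} (λ f → 𝟙 (good? (remove S⁻ L) f)) L
               (Unique.take⁺ m (Unique.filter⁺ _ e!)) (All.take⁺ m (All.all-filter _ e))
               (All.tabulate λ j∈L → good-ignores (∉-remove S⁻ j∈L))) ⟩
        b ^ m * count (remove S⁻ L)
          ≡⟨ cong (λ l → b ^ l * count (remove S⁻ L)) |L|≡m ⟨
        b ^ length L * count (remove S⁻ L)      ≤⟨ growth-remove L growth ⟩
        (2 * suc r) ^ length L * count S⁻
          ≡⟨ cong (λ l → (2 * suc r) ^ l * count S⁻) |L|≡m ⟩
        (2 * suc r) ^ m * count S⁻              ≡⟨ cong (_* count S⁻) (^-distribʳ-* 2 (suc r) m) ⟩
        2 ^ m * suc r ^ m * count S⁻            ≡⟨ xy∙z≈y∙xz (2 ^ m) (suc r ^ m) _ ⟩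
        suc r ^ m * (2 ^ m * count S⁻)          ∎)
        where
        open ≤-Reasoning
        b = suc (2 * r)
        L = rest i e
        |L|≡m = length-rest e! m<e

      -- A colouring good for `S⁻` but not for `S` violates some edge inside `S`. That edge contains
      -- `i`, since otherwise it would lie inside `S⁻` and be violated there already. Being
      -- monochromatic, it agrees with `i` on all its vertices, so it is counted by `fails`.
      union-bound : ∀ f → 𝟙 (good? S⁻ f) ≤
                          𝟙 (good? S f) + sum (map (λ e → fails e f) (filter (i ∈ₑ?_) E))
      union-bound f = 𝟙-bound (good? S⁻ f) λ good → bound good (Any.any? (violatedIn? S f) E)
        where
        failure : Good S⁻ f → ∀ {e} → e ∈ E → ViolatedIn S f e → i ∈ e × fails e f ≡ 1
        failure good {e} e∈E (e⊆S , mono) = i∈e , cong₂ _*_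
          (𝟙-yes (agree? (rest i e) i f)
                 (All.map (λ u∈e → All.lookup (All.lookup mono u∈e) i∈e) rest⊆e))
          (𝟙-yes (good? (remove S⁻ (rest i e)) f) (good-⊆ f (remove-⊆ S⁻ (rest i e)) good))
          where
          i∈e : i ∈ e
          i∈e with i ∈ₑ? e
          ... | yes i∈e = i∈e
          ... | no i∉e  = contradiction
            (lose e∈E (All.tabulate e⊆S⁻ , mono)) good
            where
            e⊆S⁻ : ∀ {u} → u ∈ e → u ∈ₛ S⁻
            e⊆S⁻ u∈e = x∈p∧x≢y⇒x∈p-y (All.lookup e⊆S u∈e) λ { refl → i∉e u∈e }
          rest⊆e : All (_∈ e) (rest i e)
          rest⊆e = All.take⁺ m (All.tabulate (proj₁ ∘ ∈-filter⁻ _))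
        bound : Good S⁻ f → (v? : Dec (Any (ViolatedIn S f) E)) →
                1 ≤ 𝟙 (¬? v?) + sum (map (λ e → fails e f) (filter (i ∈ₑ?_) E))
        bound good (no _)  = m≤m+n 1 _
        bound good (yes v) with find v
        ... | e , e∈E , violated with failure good e∈E violated
        ...   | i∈e , fails≡1 = ≤-trans (≤-reflexive (≡.sym fails≡1))
                                        (∈⇒≤sum (λ e → fails e f) (∈-filter⁺ _ e∈E i∈e))

      -- By `budget`, `K * failures` is at most `count S⁻`. Since `K = 1 + (2 * r + 1)`, the
      -- inequality is first proved as `K * count S⁻ ≤ count S⁻ + K * count S`, after which one copy
      -- of `count S⁻` is cancelled.
      growth-step : suc (2 * r) * count S⁻ ≤ 2 * suc r * count S
      growth-step = +-cancelˡ-≤ (count S⁻) _ _ (subst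
        (λ k → k * count S⁻ ≤ count S⁻ + K * count S) (*-suc 2 r) (*-cancelˡ-≤ (b ^ m) {{m^n≢0 b m}} (begin
          b ^ m * (K * count S⁻)
            ≡⟨ x∙yz≈y∙xz (b ^ m) K _ ⟩
          K * (b ^ m * count S⁻)
            ≤⟨ *-monoʳ-≤ K (*-monoʳ-≤ (b ^ m) count-S⁻) ⟩
          K * (b ^ m * (count S + failures))
            ≡⟨ cong (K *_) (*-distribˡ-+ (b ^ m) (count S) failures) ⟩
          K * (b ^ m * count S + b ^ m * failures)
            ≤⟨ *-monoʳ-≤ K (+-monoʳ-≤ (b ^ m * count S) few-failures) ⟩
          K * (b ^ m * count S + D * (2 ^ m * count S⁻))
            ≡⟨ regroup K (b ^ m) (count S) D (2 ^ m) (count S⁻) ⟩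
          K * (D * 2 ^ m) * count S⁻ + b ^ m * (K * count S)
            ≤⟨ +-monoˡ-≤ _ (*-monoˡ-≤ (count S⁻) budget) ⟩
          b ^ m * count S⁻ + b ^ m * (K * count S)
            ≡⟨ *-distribˡ-+ (b ^ m) (count S⁻) _ ⟨
          b ^ m * (count S⁻ + K * count S) ∎)))
        where
        open ≤-Reasoning
        b = suc (2 * r)
        K = 2 * suc r
        failures = total λ f → sum (map (λ e → fails e f) (filter (i ∈ₑ?_) E))
        count-S⁻ : count S⁻ ≤ count S + failures
        count-S⁻ = ≤-trans (total-mono union-bound)
                           (≤-reflexive (total-+ (λ f → 𝟙 (good? S f)) _))
        few-failures : b ^ m * failures ≤ D * (2 ^ m * count S⁻)
        few-failures = ≤-trans
          (total-sum-≤ {a = b ^ m} fails (filter (i ∈ₑ?_) E)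
            (All.zipWith (λ (e! , m<e) → total-fails e! m<e)
              (All.filter⁺ (i ∈ₑ?_) unique , All.filter⁺ (i ∈ₑ?_) uniform)))
          (*-monoˡ-≤ (2 ^ m * count S⁻) (sparse i))
        regroup : ∀ K p c D q c′ → K * (p * c + D * (q * c′)) ≡ K * (D * q) * c′ + p * (K * c)
        regroup = solve-∀

    -- The induction runs over all proper subsets of `S`, because bounding the loss at `i` deletes
    -- further vertices of the edges through `i` from `S - i`.
    growth : ∀ {S} → Acc _⊂_ S → Growth S
    growth {S} (acc smaller) i with i ∈? S
    ... | yes i∈S = growth-step i S λ T⊆S⁻ →
                      growth (smaller (⊆-⊂-trans T⊆S⁻ (x∈p⇒p-x⊂p i∈S)))
    -- Nothing is deleted here, so no colouring is lost and `2 * r + 1 ≤ 2 * r + 2` suffices.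
    ... | no i∉S  = *-mono-≤ (subst (suc (2 * r) ≤_) (≡.sym (*-suc 2 r)) (n≤1+n _))
                             (total-mono λ f → 𝟙-mono (good? (S - i) f) (good? S f) (good-⊆ f S⊆S⁻))
      where
      S⊆S⁻ : S ⊆ S - i
      S⊆S⁻ u∈S = x∈p∧x≢y⇒x∈p-y u∈S λ { refl → i∉S u∈S }

    -- Deleting all vertices one after another compares `count ⊤` with the count for the empty set,
    -- where every colouring is good; if the former vanished, so would the latter.
    count-⊤-positive : 0 < count ⊤
    count-⊤-positive = n≢0⇒n>0 λ count≡0 → <⇒≱ positive (≤-trans
      (growth-remove (allFin N) (λ _ → growth (⊂-wellFounded _)))
      (≤-reflexive (trans (cong (K^N *_) count≡0) (*-zeroʳ K^N))))
      where
      K^N = (2 * suc r) ^ length (allFin N)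
      ∅ = remove ⊤ (allFin N)
      good-∅ : (f : Colouring (suc r) N) → Good ∅ f
      good-∅ f v with find v
      -- An empty edge would be violated vacuously, even in the empty set; `uniform` excludes it.
      ... | []    , e∈E , _             = n≮0 (All.lookup uniform e∈E)
      ... | u ∷ _ , _   , u∈∅ ∷ _ , _   = ∉-remove ⊤ (∈-allFin u) u∈∅
      count-∅ : 0 < count ∅
      count-∅ = subst (0 <_) (total-cong λ f → ≡.sym (𝟙-yes (good? ∅ f) (good-∅ f))) (total-one N)
        where
        total-one : ∀ n → 0 < total {suc r} {n} (λ _ → 1)
        total-one zero    = z<s
        total-one (suc n) = <-≤-trans (total-one n) (m≤m+n _ _)
      positive : 0 < suc (2 * r) ^ length (allFin N) * count ∅
      positive = *-mono-≤ (m^n>0 (suc (2 * r)) (length (allFin N))) count-∅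

    non-monochromatic-colouring : Σ (Colouring (suc r) N) λ f → All (λ e → ¬ Monochromatic f e) E
    non-monochromatic-colouring with total-positive _ count-⊤-positive
    ... | f , 0<𝟙 = f , All.map (λ ¬v mono → ¬v (All.tabulate (λ _ → ∈⊤) , mono))
                               (All.¬Any⇒All¬ E (𝟙-positive (good? ⊤ f) 0<𝟙))

¬monochromatic⇒split : (f : Colouring k N) (e : Edge N) → ¬ Monochromatic f e →
                       ∃ λ u → ∃ λ w → u ∈ e × w ∈ e × lookup f u ≢ lookup f w
¬monochromatic⇒split f e ¬mono
  with find (All.¬All⇒Any¬ (λ u → All.all? (λ w → lookup f u Fin.≟ lookup f w) e) e ¬mono)
... | u , u∈e , ¬same with find (All.¬All⇒Any¬ (λ w → lookup f u Fin.≟ lookup f w) e ¬same)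
...   | w , w∈e , differ = u , w , u∈e , w∈e , differ

-- The hypergraph of neighbourhoods of a graph.

module _ {n} (G : Graph n) where

  adj? : ∀ u v → Dec (Adj G u v)
  adj? u v = adj G u v Bool.≟ true

  neighbours : Fin n → Edge n
  neighbours v = filter (adj? v) (allFin n)

  ∈-neighbours⁺ : ∀ {u v} → Adj G v u → u ∈ neighbours v
  ∈-neighbours⁺ {u} {v} = ∈-filter⁺ (adj? v) (∈-allFin u)

  ∈-neighbours⁻ : ∀ {u v} → u ∈ neighbours v → Adj G v u
  ∈-neighbours⁻ {v = v} u∈ = proj₂ (∈-filter⁻ (adj? v) {xs = allFin n} u∈)

  neighbourhoods : List (Edge n)
  neighbourhoods = map neighbours (allFin n)

  length-neighbours : ∀ v → length (neighbours v) ≡ deg G v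
  length-neighbours v = go (allFin n)
    where
    go : ∀ us → length (filter (adj? v) us) ≡ sum (map (λ u → if adj G v u then 1 else 0) us)
    go []       = refl
    go (u ∷ us) with adj G v u
    ... | true  = cong suc (go us)
    ... | false = go us

  -- By symmetry, `i` lies in the neighbourhood of `u` exactly when `u` is a neighbour of `i`. The
  -- list has one entry per vertex, so coinciding neighbourhoods are counted separately and equality
  -- holds.
  neighbourhoods-through : ∀ i → length (filter (i ∈ₑ?_) neighbourhoods) ≡ deg G i
  neighbourhoods-through i = trans (go (allFin n)) (length-neighbours i)
    where
    go : ∀ us → length (filter (i ∈ₑ?_) (map neighbours us)) ≡
                length (filter (adj? i) us)
    go [] = refl
    go (u ∷ us) with i ∈ₑ? neighbours u | adj? i u
    ... | yes _  | yes _   = cong suc (go us)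
    ... | no _   | no _    = go us
    ... | yes i∈ | no ¬iu  = contradiction (trans (Graph.sym G i u) (∈-neighbours⁻ i∈)) ¬iu
    ... | no i∉  | yes iu  = contradiction (∈-neighbours⁺ (trans (Graph.sym G u i) iu)) i∉

module _ {n} (G : Graph (suc n)) where

  minDeg≤deg : ∀ v → minDeg G ≤ deg G v
  minDeg≤deg v = foldr-preservesᵒ {P = _≤ deg G v} (λ x y → Sum.[ m≤n⇒m⊓o≤n y , m≤n⇒o⊓m≤n x ]) _ _
    (inj₂ (lose (∈-map⁺ (deg G) (∈-allFin v)) ≤-refl))

  deg≤maxDeg : ∀ v → deg G v ≤ maxDeg G
  deg≤maxDeg v = foldr-preservesᵒ {P = deg G v ≤_} (λ x y → Sum.[ m≤n⇒m≤n⊔o y , m≤n⇒m≤o⊔n x ]) _ _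
    (inj₂ (lose (∈-map⁺ (deg G) (∈-allFin v)) ≤-refl))

-- Arithmetic of the ceiling and of the degree condition.

ceilDiv-bound : ∀ a b → a ≤ ceilDiv a (suc b) * suc b
ceilDiv-bound a b = +-cancelʳ-≤ b _ _ (begin
  a + b                                               ≡⟨ m≡m%n+[m/n]*n (a + b) (suc b) ⟩
  -- The remainder is at most `b`, which is paid for by the `b` added for rounding up.
  (a + b) % suc b + (a + b) / suc b * suc b           ≤⟨ +-monoˡ-≤ _ (≤-pred (m%n<n (a + b) (suc b))) ⟩
  b + (a + b) / suc b * suc b                         ≡⟨ +-comm b _ ⟩
  (a + b) / suc b * suc b + b                         ∎)
  where open ≤-Reasoning

-- The source of the constant 11: with `d = 11 + t` this is `2^d * d ≤ 4 * 3^(d - 3)`, which fails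
-- at `d = 10`. From `d` to `d + 1` the left side grows by `2 (d + 1) / d ≤ 3`, the right side by
-- exactly 3.
exponential-budget : ∀ t → 2 * 2 ^ (10 + t) * (11 + t) ≤ 4 * 3 ^ (8 + t)
exponential-budget zero    = ≤ᵇ⇒≤ 22528 26244 _
exponential-budget (suc t) = begin
  2 * (2 * 2 ^ (10 + t)) * (12 + t)        ≡⟨ e₁ (2 ^ (10 + t)) t ⟩
  2 * 2 ^ (10 + t) * (24 + 2 * t)
    ≤⟨ *-monoʳ-≤ (2 * 2 ^ (10 + t)) (≤-trans (m≤m+n _ (9 + t)) (≤-reflexive (e₂ t))) ⟩
  2 * 2 ^ (10 + t) * (3 * (11 + t))        ≡⟨ e₃ (2 * 2 ^ (10 + t)) (11 + t) ⟩
  3 * (2 * 2 ^ (10 + t) * (11 + t))        ≤⟨ *-monoʳ-≤ 3 (exponential-budget t) ⟩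
  3 * (4 * 3 ^ (8 + t))                    ≡⟨ e₄ (3 ^ (8 + t)) ⟩
  4 * (3 * 3 ^ (8 + t))                    ∎
  where
  open ≤-Reasoning
  e₁ : ∀ p t → 2 * (2 * p) * (12 + t) ≡ 2 * p * (24 + 2 * t)
  e₁ = solve-∀
  e₂ : ∀ t → 24 + 2 * t + (9 + t) ≡ 3 * (11 + t)
  e₂ = solve-∀
  e₃ : ∀ p q → p * (3 * q) ≡ 3 * (p * q)
  e₃ = solve-∀
  e₄ : ∀ p → 3 * (4 * p) ≡ 4 * (3 * p)
  e₄ = solve-∀

-- As 4 r (r + 1) ≤ (2 r + 1)², two of the factors 2 r + 1 absorb the dependence on r.
degree-budget : ∀ r t {D} → 1 ≤ r → D ≤ r * (11 + t) →
                2 * suc r * (D * 2 ^ (10 + t)) ≤ suc (2 * r) ^ (10 + t)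
degree-budget r t {D} 1≤r D≤ = *-cancelˡ-≤ 4 (begin
  4 * (2 * suc r * (D * 2 ^ (10 + t)))
    ≤⟨ *-monoʳ-≤ 4 (*-monoʳ-≤ (2 * suc r) (*-monoˡ-≤ (2 ^ (10 + t)) D≤)) ⟩
  4 * (2 * suc r * (r * (11 + t) * 2 ^ (10 + t)))
    ≡⟨ e₁ r (11 + t) (2 ^ (10 + t)) ⟩
  4 * (r * suc r) * (2 * 2 ^ (10 + t) * (11 + t))
    ≤⟨ *-mono-≤ (≤-trans (n≤1+n _) (≤-reflexive (e₂ r))) (exponential-budget t) ⟩
  suc (2 * r) * suc (2 * r) * (4 * 3 ^ (8 + t))
    ≤⟨ *-monoʳ-≤ (b * b) (*-monoʳ-≤ 4 (^-monoˡ-≤ (8 + t) (s≤s (*-monoʳ-≤ 2 1≤r)))) ⟩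
  b * b * (4 * b ^ (8 + t))
    ≡⟨ e₃ b (b ^ (8 + t)) ⟩
  4 * (b * (b * b ^ (8 + t))) ∎)
  where
  open ≤-Reasoning
  b = suc (2 * r)
  e₁ : ∀ r d p → 4 * (2 * suc r * (r * d * p)) ≡ 4 * (r * suc r) * (2 * p * d)
  e₁ = solve-∀
  e₂ : ∀ r → suc (4 * (r * suc r)) ≡ suc (2 * r) * suc (2 * r)
  e₂ = solve-∀
  e₃ : ∀ b p → b * b * (4 * p) ≡ 4 * (b * (b * p))
  e₃ = solve-∀

-- From hypergraph colourings to dynamic colourings.

dynamic-2k : ∀ {n} (G : Graph n) → Bipartite G → (f : Colouring k n) →
             All (λ e → ¬ Monochromatic f e) (neighbourhoods G) → DynColorable G (2 * k)
dynamic-2k G (side , proper) f split =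
  c , (λ u v uv → proper u v uv ∘ Fin.combine-injectiveˡ _ _ _ _) , dynamic
  where
  -- The side separates adjacent vertices. The neighbours of one vertex share a side, so two
  -- different colours among them must come from `f`.
  c = λ v → combine (side v) (lookup f v)
  dynamic : ∀ v → 2 ≤ deg G v → ∃ λ u → ∃ λ w → Adj G v u × Adj G v w × c u ≢ c w
  dynamic v _
    with ¬monochromatic⇒split f (neighbours G v)
           (All.lookup split (∈-map⁺ (neighbours G) (∈-allFin v)))
  ... | u , w , u∈ , w∈ , fu≢fw =
    u , w , ∈-neighbours⁻ G u∈ , ∈-neighbours⁻ G w∈ ,
    fu≢fw ∘ Fin.combine-injectiveʳ (side u) _ (side w) _

two≤colours : ∀ {n} (G : Graph n) {v} → 1 ≤ deg G v → ∀ {j} → Colorable G j → 2 ≤ j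
two≤colours G {v} 1≤deg (c , proper) with neighbours G v in eq
... | []    = contradiction
  (subst (1 ≤_) (trans (≡.sym (length-neighbours G v)) (cong length eq)) 1≤deg) n≮0
... | u ∷ _ = two-values (proper v u (∈-neighbours⁻ G (subst (u ∈_) (≡.sym eq) (here refl))))
  where
  two-values : ∀ {j} {a b : Fin j} → a ≢ b → 2 ≤ j
  two-values {suc zero}    {zero} {zero} a≢b = contradiction refl a≢b
  two-values {suc (suc _)} _   = s≤s (s≤s z≤n)

theorem9 : Σ ℕ (λ δ₀ → 1 ≤ δ₀ ×
    (∀ n (G : Graph (suc n)) → Bipartite G → δ₀ ≤ minDeg G →
    ∀ χ χ₂ → IsChromaticNumber G χ → IsDynChromaticNumber G χ₂ →
    χ₂ ≤ χ + 2 * ceilDiv (maxDeg G) (minDeg G)))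
theorem9 = 11 , s≤s z≤n , bound
  where
  bound : ∀ n (G : Graph (suc n)) → Bipartite G → 11 ≤ minDeg G →
          ∀ χ χ₂ → IsChromaticNumber G χ → IsDynChromaticNumber G χ₂ →
          χ₂ ≤ χ + 2 * ceilDiv (maxDeg G) (minDeg G)
  bound n G bip δ₀≤δ χ χ₂ (χ-colouring , _) (_ , χ₂-least)
    with minDeg G in δ≡ | δ₀≤δ
  -- Writing `δ` as `11 + t` exhibits it as a successor, which takes `ceilDiv` out of its default
  -- case.
  ... | δ | 11≤δ with m≤n⇒∃[o]m+o≡n 11≤δ
  ...   | t , refl = begin
    χ₂             ≤⟨ χ₂-least (2 * suc r) (dynamic-2k G bip (proj₁ colouring) (proj₂ colouring)) ⟩
    2 * suc r      ≡⟨ *-suc 2 r ⟩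
    2 + 2 * r      ≤⟨ +-monoˡ-≤ (2 * r) (two≤colours G 1≤deg χ-colouring) ⟩
    χ + 2 * r      ∎
    where
    open ≤-Reasoning
    r = ceilDiv (maxDeg G) (11 + t)
    δ≤deg : ∀ v → 11 + t ≤ deg G v
    δ≤deg v = subst (_≤ deg G v) δ≡ (minDeg≤deg G v)
    1≤deg : 1 ≤ deg G zero
    1≤deg = ≤-trans (s≤s z≤n) (δ≤deg zero)
    Δ≤rδ : maxDeg G ≤ r * (11 + t)
    Δ≤rδ = ceilDiv-bound (maxDeg G) (10 + t)
    1≤r : 1 ≤ r
    1≤r = n≢0⇒n>0 λ r≡0 → n≮0 (≤-trans 1≤deg (≤-trans (deg≤maxDeg G zero)
            (subst (λ r → maxDeg G ≤ r * (11 + t)) r≡0 Δ≤rδ)))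
    -- The exponent is `m = δ - 1`, as edges must have strictly more than `m` vertices; `D` is the
    -- maximum degree.
    colouring = non-monochromatic-colouring (neighbourhoods G) r (10 + t) (maxDeg G)
      (All.map⁺ (All.tabulate λ {v} _ → Unique.filter⁺ (adj? G v) (Unique.allFin⁺ (suc n))))
      (All.map⁺ (All.tabulate λ {v} _ → subst (11 + t ≤_) (≡.sym (length-neighbours G v)) (δ≤deg v)))
      (λ i → ≤-trans (≤-reflexive (neighbourhoods-through G i)) (deg≤maxDeg G i))
      (degree-budget r t 1≤r Δ≤rδ)
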